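{- For any infinite binary information system $U$, the function $L_U^{ld}(n)$ has one of the following two types of behavior: (POL) If the system $U$ has finite I-dimension, then for any $n\in\mathbb{N}$, \[2(n+1)\le L_U^{ld}(n)\le 2(4n)^{I(U)}.\] (EXP) If the system $U$ has infinite I-dimension, then for any $n\in\mathbb{N}$, \[L_U^{ld}(n)=2^{n+1}.\]
   Context: $\mathbb{N}=\{1,2,\ldots\}$. An infinite binary information system is a pair $U=(A,F)$ where $A$ is an infinite set (of objects) and $F$ is an infinite set of functions $A\to\{0,1\}$ (attributes). A problem over $U$ is a tuple $z=(\nu,f_1,\ldots,f_n)$ with $n\in\mathbb{N}$, $\nu:\{0,1\}^n\to\mathbb{N}$ and $f_1,\ldots,f_n\in F$ (not necessarily distinct); $z(a)=\nu(f_1(a),\ldots,f_n(a))$ for $a\in A$, and $\dim z=n$. Decision trees. A decision tree over $U$ is a finite directed rooted tree in which the root and the edges leaving the root are unlabeled, each terminal node is labeled with a number from $\mathbb{N}$, each working node (neither the root nor terminal) is labeled with an attribute from $F$, and each edge leaving a working node is labeled with a number from $\{0,1\}$ (the root is not terminal). It is deterministic if exactly one edge leaves the root and edges leaving any working node have different labels. A complete path $\xi$ is a directed path from the root to a terminal node; $A(\xi)$ is the set of all $a\in A$ such that, for each working node of $\xi$, labeled with attribute $f$ and followed in $\xi$ by an edge labeled $\delta$, one has $f(a)=\delta$ ($A(\xi)=A$ if $\xi$ has no working nodes). $L(\Gamma)$ is the number of all nodes of $\Gamma$, including the root. $\Gamma$ is a decision tree over the problem $z=(\nu,f_1,\ldots,f_n)$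 if all its working nodes are labeled with attributes from $\{f_1,\ldots,f_n\}$. A decision tree $\Gamma$ over $z$ solves $z$ deterministically if $\Gamma$ is deterministic, for every $a\in A$ there is a complete path $\xi$ with $a\in A(\xi)$, and for every $a\in A$ and every complete path $\xi$ with $a\in A(\xi)$ the terminal node of $\xi$ is labeled $z(a)$. $L_U^{ld}(z)$ is the minimum number of nodes of a decision tree over $z$ solving $z$ deterministically, and $L_U^{ld}(n)=\max L_U^{ld}(z)$ over all problems $z$ over $U$ with $\dim z\le n$. I-dimension. A finite set $\{f_1,\ldots,f_m\}\subseteq F$ (of cardinality $m$) is independent if for all $\delta_1,\ldots,\delta_m\in\{0,1\}$ the system $\{f_1(x)=\delta_1,\ldots,f_m(x)=\delta_m\}$ has a solution in $A$; the empty set is independent. The I-dimension is $I(U)=\infty$ if $F$ contains independent subsets of every cardinality $m\in\mathbb{N}$; otherwise $I(U)$ is the maximum cardinality of an independent subset of $F$. -}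

module Defs where

open import Data.Bool.Base using (Bool)
open import Data.List.Base as List using (List; []; _∷_; length)
open import Data.List.Membership.Propositional using () renaming (_∈_ to _∈ₗ_)
open import Data.List.Relation.Unary.All using (All)
open import Data.List.Relation.Unary.Enumerates.Setoid using (IsEnumeration)
open import Data.List.Relation.Unary.Unique.Propositional using () renaming (Unique to UniqueList)
open import Data.List.NonEmpty.Base using (List⁺; _∷_; toList)
open import Data.Nat.Base using (ℕ; suc; _+_; _≤_; NonZero)
open import Data.Nat.Properties using (≤-antisym)
open import Data.Product.Base using (Σ; ∃; ∃-syntax; _×_; _,_; proj₁; proj₂)
open import Data.Refinement.Base using (Refinement-syntax)
open import Data.Unit.Base using (⊤)
open import Data.Vec.Base as Vec using (Vec)
import Data.Vec.Membership.Setoid as VecMem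
import Data.Vec.Relation.Unary.Unique.Setoid as VecUnique
open import Level using (Level; _⊔_) renaming (suc to lsuc)
open import Relation.Binary.Bundles using (Setoid)
import Relation.Binary.Construct.On as On
open import Relation.Binary.PropositionalEquality using (_≡_; refl; setoid; _→-setoid_; subst)
open import Relation.Nullary.Negation using (¬_)
open import Relation.Unary using (Pred)

private
  variable
    a ℓ p : Level

-- The paper's ℕ = {1, 2, …}.
ℕ⁺ : Set
ℕ⁺ = [ n ∈ ℕ ∣ NonZero n ]

Infinite : Setoid a ℓ → Set (a ⊔ ℓ)
Infinite S = ¬ (∃[ xs ] IsEnumeration S xs)

-- The set F is a predicate on functions.  Its elements are compared pointwise,
-- whatever their membership proofs.
attributeSetoid : {A : Set a} → Pred (A → Bool) ℓ → Setoid (a ⊔ ℓ) a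
attributeSetoid {A = A} F = On.setoid {B = ∃ F} (A →-setoid Bool) proj₁

record InfoSystem (a ℓ : Level) : Set (lsuc (a ⊔ ℓ)) where
  field
    A          : Set a
    F          : Pred (A → Bool) ℓ
    A-infinite : Infinite (setoid A)
    F-infinite : Infinite (attributeSetoid F)

  Attribute : Set (a ⊔ ℓ)
  Attribute = ∃ F

  infix 8 _at_
  _at_ : Attribute → A → Bool
  f at x = proj₁ f x

  values : ∀ {n} → Vec Attribute n → A → Vec Bool n
  values fs x = Vec.map (_at x) fs

  open VecMem (attributeSetoid F) public using (_∈_)
  open VecUnique (attributeSetoid F) public using (Unique)

module _ (U : InfoSystem a ℓ) where
  open InfoSystem U

  record Problem : Set (a ⊔ ℓ) where
    field
      dim         : ℕ
      {{dim≢0}}   : NonZero dim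
      ν           : Vec Bool dim → ℕ⁺
      attributes  : Vec Attribute dim

    value : A → ℕ⁺
    value x = ν (values attributes x)

  -- The nodes other than the root, each with the subtree below it.
  data Node : Set (a ⊔ ℓ) where
    terminal : ℕ⁺ → Node
    working  : Attribute → List⁺ (Bool × Node) → Node

  -- The tree is given by the targets of the edges leaving the root.
  record DecisionTree : Set (a ⊔ ℓ) where
    constructor root
    field
      children : List⁺ Node

module _ {U : InfoSystem a ℓ} where
  open InfoSystem U
  open Problem using (value) renaming (attributes to attrs)
  open DecisionTree

  mutual
    nodeSize : Node U → ℕ
    nodeSize (terminal _)               = 1
    nodeSize (working _ ((_ , t) ∷ es)) = suc (nodeSize t + edgesSize es)

    edgesSize : List (Bool × Node U) → ℕ
    edgesSize []             = 0
    edgesSize ((_ , t) ∷ es) = nodeSize t + edgesSize es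

  L : DecisionTree U → ℕ
  L Γ = suc (List.sum (List.map nodeSize (toList (children Γ))))

  data AllWorkingBelow (P : Attribute → List⁺ (Bool × Node U) → Set p) : Node U → Set (a ⊔ ℓ ⊔ p) where
    terminal : ∀ {k} → AllWorkingBelow P (terminal k)
    working  : ∀ {f es} → P f es →
               All (λ e → AllWorkingBelow P (proj₂ e)) (toList es) →
               AllWorkingBelow P (working f es)

  AllWorking : (Attribute → List⁺ (Bool × Node U) → Set p) → DecisionTree U → Set (a ⊔ ℓ ⊔ p)
  AllWorking P Γ = All (AllWorkingBelow P) (toList (children Γ))

  Deterministic : DecisionTree U → Set (a ⊔ ℓ)
  Deterministic Γ =
    length (toList (children Γ)) ≡ 1 ×
    AllWorking (λ _ es → UniqueList (List.map proj₁ (toList es))) Γ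

  -- Paths from a non-root node to a terminal node.  Membership proofs record
  -- positions, so parallel edges with equal labels and targets stay distinct.
  data Path : Node U → Set (a ⊔ ℓ) where
    stop : ∀ {k} → Path (terminal k)
    step : ∀ {f es δ t} → (δ , t) ∈ₗ toList es → Path t → Path (working f es)

  record CompletePath (Γ : DecisionTree U) : Set (a ⊔ ℓ) where
    constructor fromRoot
    field
      {child} : Node U
      edge    : child ∈ₗ toList (children Γ)
      path    : Path child

  follows : ∀ {t} → A → Path t → Set
  follows x stop                       = ⊤
  follows x (step {f = f} {δ = δ} _ ξ) = f at x ≡ δ × follows x ξ

  pathLabel : ∀ {t} → Path t → ℕ⁺
  pathLabel (stop {k}) = k
  pathLabel (step _ ξ) = pathLabel ξ

  -- x ∈A ξ: the object x lies in A(ξ).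
  infix 4 _∈A_
  _∈A_ : ∀ {Γ} → A → CompletePath Γ → Set
  x ∈A fromRoot _ ξ = follows x ξ

  terminalLabel : ∀ {Γ} → CompletePath Γ → ℕ⁺
  terminalLabel (fromRoot _ ξ) = pathLabel ξ

  TreeOver : Problem U → DecisionTree U → Set (a ⊔ ℓ)
  TreeOver z = AllWorking (λ f _ → f ∈ attrs z)

  SolvesDeterministically : DecisionTree U → Problem U → Set (a ⊔ ℓ)
  SolvesDeterministically Γ z =
    Deterministic Γ ×
    (∀ x → Σ (CompletePath Γ) λ ξ → x ∈A ξ) ×
    (∀ x (ξ : CompletePath Γ) → x ∈A ξ → terminalLabel ξ ≡ value z x)

  record IsMinNodes (z : Problem U) (m : ℕ) : Set (a ⊔ ℓ) where
    field
      attained : ∃[ Γ ] TreeOver z Γ × SolvesDeterministically Γ z × L Γ ≡ m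
      minimal  : ∀ Γ → TreeOver z Γ → SolvesDeterministically Γ z → m ≤ L Γ

-- IsL^ld U n m: the maximum L_U^{ld}(n) exists and equals m.  The second field
-- also asserts that L_U^{ld}(z) is defined for each z concerned.
record IsL^ld (U : InfoSystem a ℓ) (n m : ℕ) : Set (a ⊔ ℓ) where
  open Problem using (dim)
  field
    attained : ∃[ z ] dim {U = U} z ≤ n × IsMinNodes z m
    maximal  : ∀ z → dim {U = U} z ≤ n → ∃[ k ] IsMinNodes z k × k ≤ m

module _ {U : InfoSystem a ℓ} where

  IsMinNodes-unique : ∀ {z : Problem U} {m k} → IsMinNodes z m → IsMinNodes z k → m ≡ k
  IsMinNodes-unique p q = ≤-antisym (below p q) (below q p)
    where
    open IsMinNodes
    below : ∀ {z : Problem U} {m k} → IsMinNodes z m → IsMinNodes z k → m ≤ k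
    below p q with attained q
    ... | Γ , over , solves , refl = minimal p Γ over solves

  IsL^ld-unique : ∀ {n m k} → IsL^ld U n m → IsL^ld U n k → m ≡ k
  IsL^ld-unique p q = ≤-antisym (below p q) (below q p)
    where
    open IsL^ld
    below : ∀ {n m k} → IsL^ld U n m → IsL^ld U n k → m ≤ k
    below {k = k} p q with attained p
    ... | z , dim≤n , minₘ with maximal q z dim≤n
    ...   | _ , minₖ′ , k′≤k = subst (_≤ k) (IsMinNodes-unique minₖ′ minₘ) k′≤k

module _ (U : InfoSystem a ℓ) where
  open InfoSystem U

  -- For m = 0 this says that A is inhabited, so classically the empty set is
  -- independent, as A is infinite.
  Independent : ∀ {m} → Vec Attribute m → Set (a ⊔ ℓ)
  Independent {m} fs = Unique fs × (∀ (δ : Vec Bool m) → ∃[ x ] values fs x ≡ δ)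

  HasIndependent : ℕ → Set (a ⊔ ℓ)
  HasIndependent m = Σ (Vec Attribute m) Independent

  InfiniteIDim : Set (a ⊔ ℓ)
  InfiniteIDim = ∀ m → .{{NonZero m}} → HasIndependent m

  FiniteIDim : Set (a ⊔ ℓ)
  FiniteIDim = ¬ InfiniteIDim

  record IsIDim (d : ℕ) : Set (a ⊔ ℓ) where
    field
      attained : HasIndependent d
      maximal  : ∀ m → HasIndependent m → m ≤ d

{-# OPTIONS --safe #-}

-- If k tuples of (f₁, …, fₙ) are realised by objects, a tree that branches on an attribute
-- only when both answers are possible has k leaves and 2k nodes.  Conversely, for an
-- injective ν every deterministic tree needs k leaves, and since its working nodes have at
-- most two children, it has at least 2k nodes.  So L_U^{ld}(n) is twice the maximal number
-- of realised tuples.  That number is 2ⁿ for independent attributes.  It is at most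
-- (n + 1)^I(U) by the Sauer–Shelah lemma, and at least n + 1: as F is infinite, some
-- attribute always splits a class of objects not separated by the attributes chosen so far.
module Submission where

open import Defs
open import Axiom.DoubleNegationElimination using (em⇒dne)
open import Axiom.ExcludedMiddle using (ExcludedMiddle)
open import Data.Bool.Base using (Bool; true; false; not; _∧_; _∨_; if_then_else_)
import Data.Bool.Properties as Bool
open import Data.Bool.Properties using (¬-not; not-involutive)
open import Data.Empty using (⊥; ⊥-elim)
open import Data.Fin.Base using (Fin; zero; suc; toℕ)
open import Data.Fin.Properties using (any?; injective⇒≤; toℕ-injective; 1↔⊤; 2↔Bool; *↔×)
open import Data.Irrelevant using ([_])
open import Data.Refinement.Base as Refinement using (_,_)
open import Data.List.Base as List using (List; []; _∷_; _++_; length; allFin)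
open import Data.List.Membership.Propositional using () renaming (_∈_ to _∈ₗ_)
open import Data.List.Membership.Propositional.Properties using (∈-++⁺ˡ; ∈-++⁺ʳ; ∈-allFin)
open import Data.List.Membership.Setoid.Properties using (index-injective)
open import Data.List.NonEmpty.Base using (List⁺; _∷_; toList)
open import Data.List.Properties using (length-++)
open import Data.List.Relation.Unary.All using ([]; _∷_)
open import Data.List.Relation.Unary.AllPairs using ([]; _∷_)
open import Data.List.Relation.Unary.Any as Any using (Any; here; there; index)
open import Data.List.Relation.Unary.Unique.Propositional using () renaming (Unique to UniqueList)
open import Data.Nat.Base using (ℕ; zero; suc; _+_; _*_; _^_; _≤_; _<_; z≤n; s≤s; NonZero;
  >-nonZero⁻¹)
open import Data.Nat.Induction using (<-rec)
open import Data.Nat.Properties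
open import Data.Nat.Tactic.RingSolver using (solve-∀)
open import Data.Product.Base using (Σ; ∃; ∃-syntax; ∃₂; _×_; _,_; proj₁; proj₂; uncurry)
open import Data.Product.Function.NonDependent.Propositional using (_×-↔_)
open import Data.Sum.Base using (inj₁; inj₂)
open import Data.Unit.Base using (tt)
open import Data.Vec.Base as Vec using (Vec; []; _∷_; lookup; uncons; fromList)
open import Data.Vec.Functional using () renaming (_∷_ to _∷ᶠ_)
open import Data.Vec.Properties using (map-∘; map-cong; lookup-map; ∷-injectiveˡ; ∷-injectiveʳ; ≡-dec)
open import Data.Vec.Relation.Unary.All as VecAll using ([]; _∷_)
open import Data.Vec.Relation.Unary.AllPairs using ([]; _∷_)
open import Data.Vec.Relation.Unary.Any using (here; there)
open import Function.Base using (_∘_; const)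
open import Function.Bundles using (_↔_; mk↔ₛ′; module Injection; module Inverse)
open import Function.Construct.Composition using (_↔-∘_)
open import Function.Construct.Symmetry using (↔-sym)
open import Function.Definitions using (Injective)
open import Function.Properties.Inverse using (↔⇒↣)
open import Level using (Level; _⊔_; Lift; lift; lower)
open import Relation.Binary.PropositionalEquality
  using (_≡_; _≢_; refl; sym; trans; cong; cong₂; subst; setoid)
open import Relation.Nullary using (Dec; yes; no; does; ¬_; contradiction; map′; recompute)
open import Relation.Nullary.Decidable using (dec-true; decidable-stable)
open import Relation.Unary using (Pred; Decidable)

private
  variable
    a b ℓ p : Level
    n m k : ℕ

-- Extremal elements, numbering of Boolean tuples, class representatives

does⁻ : {P : Set p} (P? : Dec P) → does P? ≡ true → P
does⁻ (yes p) _ = p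

module _ {P : Pred ℕ p} (P? : Decidable P) where

  least : ∀ n → P n → ∃[ m ] P m × (∀ k → P k → m ≤ k)
  least = <-rec _ λ n rec Pn → descend n rec Pn (anyUpTo? P? n)
    where
    descend : ∀ n → (∀ {m} → m < n → P m → ∃[ m ] P m × (∀ k → P k → m ≤ k)) → P n →
           Dec (∃[ m ] m < n × P m) → ∃[ m ] P m × (∀ k → P k → m ≤ k)
    descend n rec Pn (yes (m , m<n , Pm)) = rec m<n Pm
    descend n rec Pn (no none)            = n , Pn , λ k Pk → ≮⇒≥ λ k<n → none (k , k<n , Pk)

  greatest : ∀ b → (∀ k → P k → k ≤ b) → ∃ P → ∃[ m ] P m × (∀ k → P k → k ≤ m)
  greatest b bound wit with P? b
  greatest b       bound wit      | yes Pb = b , Pb , bound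
  greatest zero    bound (k , Pk) | no ¬P0 =
    contradiction (subst P (n≤0⇒n≡0 (bound k Pk)) Pk) ¬P0
  greatest (suc b) bound wit      | no ¬Pb =
    greatest b (λ k Pk → ≤-pred (≤∧≢⇒< (bound k Pk) λ { refl → ¬Pb Pk })) wit

uncons↔ : {A : Set a} → Vec A (suc n) ↔ (A × Vec A n)
uncons↔ = mk↔ₛ′ uncons (uncurry _∷_) (λ _ → refl) λ { (_ ∷ _) → refl }

tuples↔ : ∀ n → Vec Bool n ↔ Fin (2 ^ n)
tuples↔ zero    = ↔-sym 1↔⊤ ↔-∘ mk↔ₛ′ (const tt) (const []) (λ _ → refl) λ { [] → refl }
tuples↔ (suc n) = ↔-sym *↔× ↔-∘ ((↔-sym 2↔Bool ×-↔ tuples↔ n) ↔-∘ uncons↔)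

tupleIndex : Vec Bool n → Fin (2 ^ n)
tupleIndex = Inverse.to (tuples↔ _)

tupleIndex-injective : Injective _≡_ _≡_ (tupleIndex {n})
tupleIndex-injective {n} = Injection.injective (↔⇒↣ (tuples↔ n))

tuple : Fin (2 ^ n) → Vec Bool n
tuple = Inverse.from (tuples↔ _)

tuple-injective : Injective _≡_ _≡_ (tuple {n})
tuple-injective {n} = Injection.injective (↔⇒↣ (↔-sym (tuples↔ n)))

module _ {B : Set b} (c : B → Fin n) (image? : ∀ i → Dec (∃[ x ] c x ≡ i)) where

  -- One preimage is kept for every code in the image of `c`. It serves twice below: for objects up
  -- to equal tuples of values, and for attributes up to equal values on finitely many objects.
  representatives : ∃[ xs ] (∀ y → Any (λ x → c x ≡ c y) xs)
  representatives with go (allFin n)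
    where
    go : ∀ is → ∃[ xs ] (∀ y → c y ∈ₗ is → Any (λ x → c x ≡ c y) xs)
    go [] = [] , λ _ ()
    go (i ∷ is) with image? i | go is
    ... | yes (x , cx≡i) | xs , covers = x ∷ xs , λ
      { y (here cy≡i)   → here (trans cx≡i (sym cy≡i))
      ; y (there cy∈is) → there (covers y cy∈is) }
    ... | no ∄x | xs , covers = xs , λ
      { y (here cy≡i)   → contradiction (y , cy≡i) ∄x
      ; y (there cy∈is) → covers y cy∈is }
  ... | xs , covers = xs , λ y → covers y (∈-allFin (c y))

-- Sets of Boolean tuples and the Sauer–Shelah lemma

TupleSet : ℕ → Set
TupleSet n = Vec Bool n → Bool

count : TupleSet n → ℕ
count {zero}  T = if T [] then 1 else 0
count {suc n} T = count (T ∘ (false ∷_)) + count (T ∘ (true ∷_))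

count≤2^n : (T : TupleSet n) → count T ≤ 2 ^ n
count≤2^n {zero} T with T []
... | true  = ≤-refl
... | false = z≤n
count≤2^n {suc n} T = +-mono-≤ (count≤2^n (T ∘ (false ∷_))) (≤-trans (count≤2^n (T ∘ (true ∷_))) (m≤m+n _ 0))

count-empty : (T : TupleSet n) → (∀ v → T v ≢ true) → count T ≡ 0
count-empty {zero} T empty with T [] in eq
... | true  = contradiction eq (empty [])
... | false = refl
count-empty {suc n} T empty =
  cong₂ _+_ (count-empty _ (empty ∘ (false ∷_))) (count-empty _ (empty ∘ (true ∷_)))

count≡0⇒empty : (T : TupleSet n) → count T ≡ 0 → ∀ v → T v ≢ true
count≡0⇒empty {zero}  T eq [] T[] with true ← T [] | () ← eq
count≡0⇒empty {suc n} T eq (false ∷ v) = count≡0⇒empty _ (m+n≡0⇒m≡0 _ eq) v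
count≡0⇒empty {suc n} T eq (true  ∷ v) = count≡0⇒empty _ (m+n≡0⇒n≡0 (count (T ∘ (false ∷_))) eq) v

count-section≤ : (T : TupleSet (suc n)) → ∀ b → count (T ∘ (b ∷_)) ≤ count T
count-section≤ T false = m≤m+n _ _
count-section≤ T true  = m≤n+m _ _

infixr 6 _∪_
infixr 7 _∩_

_∪_ _∩_ : TupleSet n → TupleSet n → TupleSet n
(S ∪ T) v = S v ∨ T v
(S ∩ T) v = S v ∧ T v

-- Inclusion-exclusion, by induction on the first coordinate. It lets the Sauer-Shelah induction
-- trade the two sections of a set for their union and intersection.
count-∪-∩ : (S T : TupleSet n) → count S + count T ≡ count (S ∪ T) + count (S ∩ T)
count-∪-∩ {zero} S T with S [] | T []
... | true  | true  = refl
... | true  | false = refl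
... | false | true  = refl
... | false | false = refl
count-∪-∩ {suc n} S T = begin-equality
  (count S₀ + count S₁) + (count T₀ + count T₁)
    ≡⟨ interchange (count S₀) _ _ _ ⟩
  (count S₀ + count T₀) + (count S₁ + count T₁)
    ≡⟨ cong₂ _+_ (count-∪-∩ S₀ T₀) (count-∪-∩ S₁ T₁) ⟩
  (count (S₀ ∪ T₀) + count (S₀ ∩ T₀)) + (count (S₁ ∪ T₁) + count (S₁ ∩ T₁))
    ≡⟨ interchange (count (S₀ ∪ T₀)) _ _ _ ⟩
  (count (S₀ ∪ T₀) + count (S₁ ∪ T₁)) + (count (S₀ ∩ T₀) + count (S₁ ∩ T₁)) ∎
  where
  open ≤-Reasoning
  S₀ = S ∘ (false ∷_)
  S₁ = S ∘ (true ∷_)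
  T₀ = T ∘ (false ∷_)
  T₁ = T ∘ (true ∷_)
  interchange : ∀ w x y z → (w + x) + (y + z) ≡ (w + y) + (x + z)
  interchange = solve-∀

-- Indices may repeat syntactically, but a repeated index cannot receive two different bits, so a
-- shattered vector has distinct entries. For `m = 0` this says that `T` is nonempty.
Shatters : TupleSet n → Vec (Fin n) m → Set
Shatters T is = ∀ δ → ∃[ v ] T v ≡ true × Vec.map (lookup v) is ≡ δ

map-lookup-suc : ∀ {A : Set a} (x : A) (v : Vec A n) (is : Vec (Fin n) m) →
                 Vec.map (lookup (x ∷ v)) (Vec.map suc is) ≡ Vec.map (lookup v) is
map-lookup-suc x v is = sym (map-∘ (lookup (x ∷ v)) suc is)

-- A tuple of the union lies in one of the two sections; prefixing the bit of that section puts it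
-- into `T`.
shatters-∪ : (T : TupleSet (suc n)) (is : Vec (Fin n) m) →
             Shatters (T ∘ (false ∷_) ∪ T ∘ (true ∷_)) is → Shatters T (Vec.map suc is)
shatters-∪ T is shatters δ with shatters δ
... | v , Tv , eq with T (false ∷ v) in T₀v
...   | true  = false ∷ v , T₀v , trans (map-lookup-suc false v is) eq
...   | false = true  ∷ v , Tv  , trans (map-lookup-suc true v is) eq

-- A tuple of the intersection extends into `T` by either bit, so coordinate `zero` can be shattered
-- in addition.
shatters-∩ : (T : TupleSet (suc n)) (is : Vec (Fin n) m) →
             Shatters (T ∘ (false ∷_) ∩ T ∘ (true ∷_)) is → Shatters T (zero ∷ Vec.map suc is)
shatters-∩ T is shatters (b ∷ δ) with shatters δ
... | v , Tv , eq with T (false ∷ v) in T₀v | b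
...   | true  | false = false ∷ v , T₀v , cong (false ∷_) (trans (map-lookup-suc false v is) eq)
...   | true  | true  = true  ∷ v , Tv  , cong (true  ∷_) (trans (map-lookup-suc true v is) eq)

-- The sum of the binomial coefficients C(n, i) over i < m.
sauerNumber : ℕ → ℕ → ℕ
sauerNumber n       zero    = 0
sauerNumber zero    (suc m) = 1
sauerNumber (suc n) (suc m) = sauerNumber n (suc m) + sauerNumber n m

-- Pascal's rule and induction give (n+1)^(d+1) + (n+1)^d = (n+2)(n+1)^d, which is at most
-- (n+2)^(d+1).
sauerNumber-bound : ∀ n d → sauerNumber n (suc d) ≤ suc n ^ d
sauerNumber-bound zero    d       = ≤-reflexive (sym (^-zeroˡ d))
sauerNumber-bound (suc n) zero    = ≤-trans (≤-reflexive (+-identityʳ _)) (sauerNumber-bound n 0)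
sauerNumber-bound (suc n) (suc d) = begin
  sauerNumber n (suc (suc d)) + sauerNumber n (suc d)
    ≤⟨ +-mono-≤ (sauerNumber-bound n (suc d)) (sauerNumber-bound n d) ⟩
  suc n * suc n ^ d + suc n ^ d
    ≡⟨ +-comm (suc n * suc n ^ d) _ ⟩
  suc (suc n) * suc n ^ d
    ≤⟨ *-monoʳ-≤ (suc (suc n)) (^-monoˡ-≤ d (n≤1+n (suc n))) ⟩
  suc (suc n) * suc (suc n) ^ d ∎
  where open ≤-Reasoning

-- Induction following Pascal's rule. If no `suc m` indices are shattered by `T`, then none are by
-- the union of its sections, and no `m` are by their intersection, since `zero` could be added to
-- them.
sauer-shelah : ∀ m (T : TupleSet n) → (∀ (is : Vec (Fin n) m) → ¬ Shatters T is) →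
               count T ≤ sauerNumber n m
sauer-shelah zero T unshattered =
  -- Any element of `T` would shatter the empty vector of indices.
  ≤-reflexive (count-empty T λ v Tv → unshattered [] λ { [] → v , Tv , refl })
sauer-shelah {zero}  (suc m) T unshattered = count≤2^n T
sauer-shelah {suc n} (suc m) T unshattered = begin
  count T₀ + count T₁
    ≡⟨ count-∪-∩ T₀ T₁ ⟩
  count (T₀ ∪ T₁) + count (T₀ ∩ T₁)
    ≤⟨ +-mono-≤ (sauer-shelah (suc m) (T₀ ∪ T₁) λ is → unshattered _ ∘ shatters-∪ T is)
                (sauer-shelah m (T₀ ∩ T₁) λ is → unshattered _ ∘ shatters-∩ T is) ⟩
  sauerNumber n (suc m) + sauerNumber n m ∎
  where
  open ≤-Reasoning
  T₀ = T ∘ (false ∷_)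
  T₁ = T ∘ (true ∷_)

-- Sizes of decision trees

no-three-distinct : {x y z : Bool} → x ≢ y → x ≢ z → y ≢ z → ⊥
no-three-distinct x≢y x≢z y≢z = x≢y (trans (¬-not x≢z) (sym (¬-not y≢z)))

module _ {U : InfoSystem a ℓ} where
  open InfoSystem U
  open Problem using (value)

  mutual
    leaves : Node U → List ℕ⁺
    leaves (terminal k)               = k ∷ []
    leaves (working _ ((_ , t) ∷ es)) = leaves t ++ edgeLeaves es

    edgeLeaves : List (Bool × Node U) → List ℕ⁺
    edgeLeaves []             = []
    edgeLeaves ((_ , t) ∷ es) = leaves t ++ edgeLeaves es

  mutual
    pathLabel∈leaves : ∀ {t : Node U} (ξ : Path t) → pathLabel ξ ∈ₗ leaves t
    pathLabel∈leaves stop = here refl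
    pathLabel∈leaves (step {es = (_ , t) ∷ es} (here refl) ξ) = ∈-++⁺ˡ (pathLabel∈leaves ξ)
    pathLabel∈leaves (step {es = (_ , t) ∷ es} (there e) ξ)   =
      ∈-++⁺ʳ (leaves t) (pathLabel∈edgeLeaves e ξ)

    pathLabel∈edgeLeaves : ∀ {δ} {t : Node U} {es} → (δ , t) ∈ₗ es → (ξ : Path t) →
                           pathLabel ξ ∈ₗ edgeLeaves es
    pathLabel∈edgeLeaves (here refl) ξ = ∈-++⁺ˡ (pathLabel∈leaves ξ)
    pathLabel∈edgeLeaves {es = (_ , t) ∷ _} (there e) ξ =
      ∈-++⁺ʳ (leaves t) (pathLabel∈edgeLeaves e ξ)

  DistinctLabels : Attribute → List⁺ (Bool × Node U) → Set
  DistinctLabels _ es = UniqueList (List.map proj₁ (toList es))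

  -- A binary tree in which every inner node has two children and which has k leaves has 2k - 1
  -- nodes; inner nodes with one child only add to the size.
  2*leaves≤1+size : {t : Node U} → AllWorkingBelow DistinctLabels t →
                    2 * length (leaves t) ≤ suc (nodeSize t)
  2*leaves≤1+size terminal = ≤-refl
  2*leaves≤1+size (working {es = (_ , t) ∷ []} _ (dt ∷ [])) = begin
    2 * length (leaves t ++ [])  ≡⟨ cong (2 *_) (trans (length-++ (leaves t)) (+-identityʳ _)) ⟩
    2 * length (leaves t)        ≤⟨ 2*leaves≤1+size dt ⟩
    suc (nodeSize t)             ≤⟨ s≤s (m≤n⇒m≤1+n (m≤m+n _ 0)) ⟩
    suc (suc (nodeSize t + 0))   ∎
    where open ≤-Reasoning
  2*leaves≤1+size (working {es = (_ , s) ∷ (_ , t) ∷ []} _ (ds ∷ dt ∷ [])) = begin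
    2 * length (leaves s ++ leaves t ++ [])
      ≡⟨ cong (2 *_) (trans (length-++ (leaves s)) (cong (length (leaves s) +_)
           (trans (length-++ (leaves t)) (+-identityʳ _)))) ⟩
    2 * (length (leaves s) + length (leaves t))
      ≡⟨ *-distribˡ-+ 2 (length (leaves s)) _ ⟩
    2 * length (leaves s) + 2 * length (leaves t)
      ≤⟨ +-mono-≤ (2*leaves≤1+size ds) (2*leaves≤1+size dt) ⟩
    suc (nodeSize s) + suc (nodeSize t)
      ≡⟨ rearrange (nodeSize s) (nodeSize t) ⟩
    suc (suc (nodeSize s + (nodeSize t + 0))) ∎
    where
    open ≤-Reasoning
    rearrange : ∀ x y → suc x + suc y ≡ suc (suc (x + (y + 0)))
    rearrange = solve-∀
  2*leaves≤1+size (working {es = _ ∷ _ ∷ _ ∷ _} ((x≢y ∷ x≢z ∷ _) ∷ (y≢z ∷ _) ∷ _) _)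
    with () ← no-three-distinct x≢y x≢z y≢z

  -- Each object reaches a leaf labeled with its value. Distinct values sit at distinct positions of
  -- `leaves t`, and the root of the tree supplies the missing node in 2k.
  distinct-values⇒L≥ : ∀ {z : Problem U} {Γ} → SolvesDeterministically Γ z →
                       (x : Fin k → A) → Injective _≡_ _≡_ (value z ∘ x) → 2 * k ≤ L Γ
  distinct-values⇒L≥ {k} {z} {root (t ∷ [])} ((_ , dt ∷ []) , reaches , sound) x injective = begin
    2 * k                  ≤⟨ *-monoʳ-≤ 2 (injective⇒≤ leafIndex-injective) ⟩
    2 * length (leaves t)  ≤⟨ 2*leaves≤1+size dt ⟩
    suc (nodeSize t)       ≤⟨ s≤s (m≤m+n _ 0) ⟩
    suc (nodeSize t + 0)   ∎
    where
    open ≤-Reasoning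
    value∈leaves : ∀ x → value z x ∈ₗ leaves t
    value∈leaves x with reaches x
    ... | ξ@(fromRoot (here refl) path) , x∈ξ =
      subst (_∈ₗ leaves t) (sound x ξ x∈ξ) (pathLabel∈leaves path)
    leafIndex : Fin _ → Fin (length (leaves t))
    leafIndex i = index (value∈leaves (x i))
    leafIndex-injective : Injective _≡_ _≡_ leafIndex
    leafIndex-injective = injective ∘ index-injective (setoid ℕ⁺) (value∈leaves _) (value∈leaves _)

  -- Construction of small trees

  -- Correctness is demanded only on objects whose tuple lies in `T`, which shrinks to a section as
  -- attributes are processed. `Q` stays abstract because the recursion shortens `fs` while the
  -- labels must belong to the full list. The `suc` in `small` accounts for the root.
  record CompactTree (Q : Pred Attribute p) (fs : Vec Attribute n)
                     (T : TupleSet n) (ν : Vec Bool n → ℕ⁺) : Set (a ⊔ ℓ ⊔ p) where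
    field
      node     : Node U
      distinct : AllWorkingBelow DistinctLabels node
      labelled : AllWorkingBelow (λ f _ → Q f) node
      small    : suc (nodeSize node) ≤ 2 * count T
      reaches  : ∀ x → T (values fs x) ≡ true → Σ (Path node) (follows x)
      sound    : ∀ x → T (values fs x) ≡ true → (ξ : Path node) → follows x ξ →
                 pathLabel ξ ≡ ν (values fs x)

  module _ {Q : Pred Attribute p} where
    open CompactTree

    -- With the section at `not b` empty, `f` is constantly `b` on the relevant objects, so querying
    -- it would be wasted.
    skip : ∀ {f} {fs : Vec Attribute n} {T ν} b → count (T ∘ (not b ∷_)) ≡ 0 →
           CompactTree Q fs (T ∘ (b ∷_)) (ν ∘ (b ∷_)) → CompactTree Q (f ∷ fs) T ν
    skip {f = f} {fs} {T} {ν} b none Γ = record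
      { node     = node Γ
      ; distinct = distinct Γ
      ; labelled = labelled Γ
      ; small    = ≤-trans (small Γ) (*-monoʳ-≤ 2 (count-section≤ T b))
      ; reaches  = λ x Tx → reaches Γ x (transport x Tx)
      ; sound    = λ x Tx ξ x∈ξ → trans (sound Γ x (transport x Tx) ξ x∈ξ)
                     (cong (λ c → ν (c ∷ values fs x)) (sym (forced x Tx)))
      }
      where
      forced : ∀ x → T (values (f ∷ fs) x) ≡ true → f at x ≡ b
      forced x Tx = trans
        (¬-not λ eq → count≡0⇒empty _ none (values fs x)
          (subst (λ c → T (c ∷ values fs x) ≡ true) eq Tx))
        (not-involutive b)
      transport : ∀ x → T (values (f ∷ fs) x) ≡ true → T (b ∷ values fs x) ≡ true
      transport x Tx = subst (λ c → T (c ∷ values fs x) ≡ true) (forced x Tx) Tx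

    -- Sizes at most 2c - 1 and 2c' - 1 and one new node give at most 2(c + c') - 1.
    branch : ∀ {f} {fs : Vec Attribute n} {T ν} → Q f →
             CompactTree Q fs (T ∘ (false ∷_)) (ν ∘ (false ∷_)) →
             CompactTree Q fs (T ∘ (true ∷_)) (ν ∘ (true ∷_)) → CompactTree Q (f ∷ fs) T ν
    branch {f = f} {fs} {T} {ν} Qf Γ₀ Γ₁ = record
      { node     = t
      ; distinct = working (((λ ()) ∷ []) ∷ [] ∷ []) (distinct Γ₀ ∷ distinct Γ₁ ∷ [])
      ; labelled = working Qf (labelled Γ₀ ∷ labelled Γ₁ ∷ [])
      ; small    = begin
          suc (suc (nodeSize (node Γ₀) + (nodeSize (node Γ₁) + 0)))
            ≡⟨ rearrange (nodeSize (node Γ₀)) _ ⟩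
          suc (nodeSize (node Γ₀)) + suc (nodeSize (node Γ₁))
            ≤⟨ +-mono-≤ (small Γ₀) (small Γ₁) ⟩
          2 * count (T ∘ (false ∷_)) + 2 * count (T ∘ (true ∷_))
            ≡⟨ *-distribˡ-+ 2 (count (T ∘ (false ∷_))) _ ⟨
          2 * count T ∎
      ; reaches  = reachesₜ
      ; sound    = soundₜ
      }
      where
      open ≤-Reasoning
      t : Node U
      t = working f ((false , node Γ₀) ∷ (true , node Γ₁) ∷ [])
      rearrange : ∀ x y → suc (suc (x + (y + 0))) ≡ suc x + suc y
      rearrange = solve-∀
      reachesₜ : ∀ x → T (values (f ∷ fs) x) ≡ true → Σ (Path t) (follows x)
      reachesₜ x Tx with f at x in eq
      ... | false = let ξ , x∈ξ = reaches Γ₀ x Tx in step (here refl) ξ , eq , x∈ξ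
      ... | true  = let ξ , x∈ξ = reaches Γ₁ x Tx in step (there (here refl)) ξ , eq , x∈ξ
      soundₜ : ∀ x → T (values (f ∷ fs) x) ≡ true → (ξ : Path t) → follows x ξ →
               pathLabel ξ ≡ ν (values (f ∷ fs) x)
      soundₜ x Tx (step (here refl) ξ) (eq , x∈ξ) with f at x | eq
      ... | .false | refl = sound Γ₀ x Tx ξ x∈ξ
      soundₜ x Tx (step (there (here refl)) ξ) (eq , x∈ξ) with f at x | eq
      ... | .true | refl = sound Γ₁ x Tx ξ x∈ξ

    -- Nonemptiness of `T` is carried along because `small` cannot hold when the count is zero; the
    -- recursion therefore enters only nonempty sections.
    compactTree : {fs : Vec Attribute n} → VecAll.All Q fs → ∀ T ν → count T ≢ 0 →
                  CompactTree Q fs T ν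
    compactTree {fs = []} [] T ν T≢∅ = record
      { node     = terminal (ν [])
      ; distinct = terminal
      ; labelled = terminal
      ; small    = *-monoʳ-≤ 2 (n≢0⇒n>0 T≢∅)
      ; reaches  = λ _ _ → stop , tt
      ; sound    = λ { _ _ stop _ → refl }
      }
    compactTree {fs = f ∷ fs} (Qf ∷ Qfs) T ν T≢∅
      with count (T ∘ (false ∷_)) ≟ 0 | count (T ∘ (true ∷_)) ≟ 0
    ... | yes ∅₀ | yes ∅₁ = contradiction (cong₂ _+_ ∅₀ ∅₁) T≢∅
    ... | yes ∅₀ | no ≢∅₁ = skip true ∅₀ (compactTree Qfs _ _ ≢∅₁)
    ... | no ≢∅₀ | yes ∅₁ = skip false ∅₁ (compactTree Qfs _ _ ≢∅₀)
    ... | no ≢∅₀ | no ≢∅₁ = branch Qf (compactTree Qfs _ _ ≢∅₀) (compactTree Qfs _ _ ≢∅₁)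

-- Realised tuples

module _ (em : ExcludedMiddle (a ⊔ ℓ)) (U : InfoSystem a ℓ) where
  open InfoSystem U
  open Problem using (attributes; ν; dim)

  decide : (P : Set a) → Dec P
  decide P = map′ lower lift (em {Lift ℓ P})

  A-inhabited : A
  A-inhabited with decide A
  ... | yes x = x
  ... | no ∄x = contradiction ([] , λ x → contradiction x ∄x) A-infinite

  realised? : (fs : Vec Attribute n) (v : Vec Bool n) → Dec (∃[ x ] values fs x ≡ v)
  realised? fs v = decide _

  realised : Vec Attribute n → TupleSet n
  realised fs v = does (realised? fs v)

  realised-values : (fs : Vec Attribute n) → ∀ x → realised fs (values fs x) ≡ true
  realised-values fs x = dec-true (realised? fs _) (x , refl)

  realised⁻ : (fs : Vec Attribute n) → ∀ {v} → realised fs v ≡ true → ∃[ x ] values fs x ≡ v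
  realised⁻ fs {v} = does⁻ (realised? fs v)

  -- Independence

  values-select : ∀ (fs : Vec Attribute n) (is : Vec (Fin n) m) x →
                  values (Vec.map (lookup fs) is) x ≡ Vec.map (lookup (values fs x)) is
  values-select fs is x =
    trans (sym (map-∘ (_at x) (lookup fs) is))
          (map-cong (λ i → sym (lookup-map i (_at x) fs)) is)

  -- Attributes that agree everywhere can never take the values `true` and `false` at the same
  -- object.
  realises-all⇒unique : (fs : Vec Attribute n) → (∀ δ → ∃[ x ] values fs x ≡ δ) → Unique fs
  realises-all⇒unique [] all = []
  realises-all⇒unique (f ∷ fs) all = apart fs (λ δ → let x , eq = all (true ∷ δ) in
      x , ∷-injectiveˡ eq , ∷-injectiveʳ eq)
    ∷ realises-all⇒unique fs λ δ → let x , eq = all (true ∷ δ) in x , ∷-injectiveʳ eq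
    where
    apart : ∀ {k} (gs : Vec Attribute k) → (∀ δ → ∃[ x ] f at x ≡ true × values gs x ≡ δ) →
            VecAll.All (λ g → ¬ (∀ x → f at x ≡ g at x)) gs
    apart [] _ = []
    apart (g ∷ gs) all =
      (λ f≗g → let x , fx , eq = all (false ∷ Vec.replicate _ false) in
        contradiction (trans (sym fx) (trans (f≗g x) (∷-injectiveˡ eq))) λ ())
      ∷ apart gs λ δ → let x , fx , eq = all (false ∷ δ) in x , fx , ∷-injectiveʳ eq

  shatters⇒independent : (fs : Vec Attribute n) (is : Vec (Fin n) m) →
                         Shatters (realised fs) is → Independent U (Vec.map (lookup fs) is)
  shatters⇒independent fs is shatters = realises-all⇒unique _ all , all
    where
    all : ∀ δ → ∃[ x ] values (Vec.map (lookup fs) is) x ≡ δ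
    all δ with shatters δ
    ... | v , Tv , eq with realised⁻ fs Tv
    ...   | x , refl = x , trans (values-select fs is x) eq

  HasIndependent-pred : ∀ m → HasIndependent U (suc m) → HasIndependent U m
  HasIndependent-pred m (f ∷ fs , _ , all) = fs , realises-all⇒unique fs all′ , all′
    where
    all′ : ∀ δ → ∃[ x ] values fs x ≡ δ
    all′ δ = let x , eq = all (true ∷ δ) in x , ∷-injectiveʳ eq

  HasIndependent-antitone : m ≤ n → HasIndependent U n → HasIndependent U m
  HasIndependent-antitone {n = zero}  z≤n h = h
  HasIndependent-antitone {n = suc n} m≤1+n h with m≤n⇒m<n∨m≡n m≤1+n
  ... | inj₁ m<1+n = HasIndependent-antitone (≤-pred m<1+n) (HasIndependent-pred n h)
  ... | inj₂ refl  = h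

  -- Independent families can be shortened, so one size `m` without any bounds all sizes that occur,
  -- and a greatest one exists.
  FiniteIDim⇒IsIDim : FiniteIDim U → ∃[ d ] IsIDim U d
  FiniteIDim⇒IsIDim finite with em {∃[ m ] ¬ HasIndependent U m}
  ... | no ∄m = ⊥-elim (finite λ m → em⇒dne em λ ¬h → ∄m (m , ¬h))
  ... | yes (m , ¬h) =
    let d , h , max = greatest (λ _ → em) m
          (λ k hₖ → ≰⇒≥ λ m≤k → ¬h (HasIndependent-antitone m≤k hₖ))
          -- The search needs some size that occurs: the empty family is independent because `A` is
          -- inhabited.
          (0 , [] , [] , λ { [] → A-inhabited , refl })
    in d , record { attained = h ; maximal = max }

  -- A shattered vector of `suc d` indices would select `suc d` independent attributes.
  IsIDim⇒count≤ : ∀ {d} → IsIDim U d → (fs : Vec Attribute n) → count (realised fs) ≤ suc n ^ d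
  IsIDim⇒count≤ {n} {d} isDim fs = ≤-trans
    (sauer-shelah (suc d) (realised fs) λ is shatters →
      1+n≰n (IsIDim.maximal isDim (suc d) (_ , shatters⇒independent fs is shatters)))
    (sauerNumber-bound n d)

  -- Separating n + 1 objects by n attributes

  Splits : Vec Attribute n → Attribute → A → A → Set
  Splits fs f x y = values fs x ≡ values fs y × f at x ≢ f at y

  -- An attribute that splits no class of fs is determined by its values on representatives
  -- of the classes.
  unsplit⇒finite : (fs : Vec Attribute n) → (∀ f x y → ¬ Splits fs f x y) →
                   ¬ Infinite (attributeSetoid F)
  unsplit⇒finite fs unsplit infinite
    with representatives (tupleIndex ∘ values fs) (λ _ → decide _)
  ... | xs , xs-cover with representatives code (λ _ → em)
    where
    code : Attribute → Fin (2 ^ length xs)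
    code f = tupleIndex (Vec.map (f at_) (fromList xs))
  ... | gs , gs-cover = infinite
    (gs , λ f → Any.map (λ {g} eq x → agree f g xs (tupleIndex-injective (sym eq))
                                        (Any.map tupleIndex-injective (xs-cover x)))
                        (gs-cover f))
    where
    agree : ∀ f g ys → Vec.map (f at_) (fromList ys) ≡ Vec.map (g at_) (fromList ys) →
            ∀ {y} → Any (λ x → values fs x ≡ values fs y) ys → f at y ≡ g at y
    agree f g (x ∷ ys) eq {y} (here x~y) =
      trans (sym (constant f)) (trans (∷-injectiveˡ eq) (constant g))
      where
      constant : ∀ h → h at x ≡ h at y
      constant h = decidable-stable (h at x Bool.≟ h at y) λ hx≢hy → unsplit h x y (x~y , hx≢hy)
    agree f g (x ∷ ys) eq (there y∈) = agree f g ys (∷-injectiveʳ eq) y∈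

  Separates : Vec Attribute n → (Fin k → A) → Set
  Separates fs x = Injective _≡_ _≡_ (values fs ∘ x)

  separates-extend : ∀ {f : Attribute} {fs : Vec Attribute n} {x : Fin k → A} {y} →
                     Separates fs x → (∀ i → values (f ∷ fs) (x i) ≢ values (f ∷ fs) y) →
                     Separates (f ∷ fs) (y ∷ᶠ x)
  separates-extend sep new {zero}  {zero}  eq = refl
  separates-extend sep new {zero}  {suc j} eq = contradiction (sym eq) (new j)
  separates-extend sep new {suc i} {zero}  eq = contradiction eq (new i)
  separates-extend sep new {suc i} {suc j} eq = cong suc (sep (∷-injectiveʳ eq))

  -- Take `f` splitting `y` and `z` within one class of `fs`. At least one of the two differs under
  -- `f ∷ fs` from every object chosen so far, and is added.
  separated-objects : ∀ n → ∃₂ λ (fs : Vec Attribute n) (x : Fin (suc n) → A) → Separates fs x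
  separated-objects zero = [] , (λ _ → A-inhabited) , λ { {zero} {zero} _ → refl }
  separated-objects (suc n) with separated-objects n
  ... | fs , x , sep with em {∃[ f ] ∃₂ (Splits fs f)}
  ...   | no unsplit =
    contradiction F-infinite (unsplit⇒finite fs λ f y z s → unsplit (f , y , z , s))
  ...   | yes (f , y , z , y~z , fy≢fz)
    with any? (λ i → ≡-dec Bool._≟_ (values (f ∷ fs) (x i)) (values (f ∷ fs) y))
       | any? (λ i → ≡-dec Bool._≟_ (values (f ∷ fs) (x i)) (values (f ∷ fs) z))
  ...     | no y-new | _ =
    f ∷ fs , y ∷ᶠ x , separates-extend {f = f} {fs = fs} {x = x} sep λ i eq → y-new (i , eq)
  ...     | yes _ | no z-new =
    f ∷ fs , z ∷ᶠ x , separates-extend {f = f} {fs = fs} {x = x} sep λ i eq → z-new (i , eq)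
  -- If both were already matched, equality on `fs` would force `i` and `j` to coincide, and `f`
  -- would agree on `y` and `z`.
  ...     | yes (i , xi~y) | yes (j , xj~z)
    with refl ← sep {i} {j} (trans (∷-injectiveʳ xi~y) (trans y~z (sym (∷-injectiveʳ xj~z))))
    = contradiction (trans (sym (∷-injectiveˡ xi~y)) (∷-injectiveˡ xj~z)) fy≢fz

  -- The minimum and the maximum

  -- The compact tree for the realised tuples solves `z`, so a least size exists and does not exceed
  -- the size of that tree.
  minNodes : (z : Problem U) → ∃[ m ] IsMinNodes z m × m ≤ 2 * count (realised (attributes z))
  minNodes z =
    let m , (Γ , over , solves , LΓ≡m) , min = least {P = Attained} (λ _ → em) (L tree) attained
    in m , record { attained = Γ , over , solves , LΓ≡m
                  ; minimal  = λ Γ over solves → min (L Γ) (Γ , over , solves , refl) }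
         , ≤-trans (min (L tree) attained) L-tree≤
    where
    fs = attributes z
    members : ∀ {k} (gs : Vec Attribute k) → VecAll.All (_∈ gs) gs
    members []       = []
    members (g ∷ gs) = here (λ _ → refl) ∷ VecAll.map there (members gs)
    realised≢∅ : count (realised fs) ≢ 0
    realised≢∅ eq = count≡0⇒empty (realised fs) eq _ (realised-values fs A-inhabited)
    open CompactTree (compactTree (members fs) (realised fs) (ν z) realised≢∅)
    tree : DecisionTree U
    tree = root (node ∷ [])
    Attained : ℕ → Set (a ⊔ ℓ)
    Attained m = ∃[ Γ ] TreeOver z Γ × SolvesDeterministically Γ z × L Γ ≡ m
    attained : Attained (L tree)
    attained = tree , labelled ∷ [] , ((refl , distinct ∷ []) ,
      (λ x → let ξ , x∈ξ = reaches x (realised-values fs x) in fromRoot (here refl) ξ , x∈ξ) ,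
      (λ { x (fromRoot (here refl) ξ) → sound x (realised-values fs x) ξ })) , refl
    L-tree≤ : L tree ≤ 2 * count (realised fs)
    L-tree≤ = ≤-trans (≤-reflexive (cong suc (+-identityʳ _))) small

  -- An injective `ν` turns separated objects into objects with distinct values.
  separates⇒IsMinNodes≥ : .{{_ : NonZero n}} → {fs : Vec Attribute n} {x : Fin k → A} →
                          Separates fs x → ∃[ z ] dim z ≡ n × (∀ {m} → IsMinNodes z m → 2 * k ≤ m)
  separates⇒IsMinNodes≥ {n} {k} {{n≢0}} {fs} {x} sep = z , refl , bound
    where
    z : Problem U
    z = record { dim = n ; dim≢0 = recompute (nonZero? n) n≢0
               -- Tuples are numbered from 0, so one is added to obtain a positive value.
               ; ν = λ v → suc (toℕ (tupleIndex v)) , [ _ ] ; attributes = fs }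
    bound : ∀ {m} → IsMinNodes z m → 2 * k ≤ m
    bound min with IsMinNodes.attained min
    ... | Γ , _ , solves , refl = distinct-values⇒L≥ {z = z} solves x
      λ eq → sep (tupleIndex-injective (toℕ-injective (suc-injective (cong Refinement.value eq))))

  -- The minimal sizes for problems of dimension at most `n` are bounded by `2 * K` through compact
  -- trees, and the problem with injective `ν` shows that one exists and is at least `2 * k`. Hence
  -- their maximum exists between the bounds.
  bounds⇒IsL^ld : .{{_ : NonZero n}} → {fs : Vec Attribute n} {x : Fin k → A} →
                  Separates fs x → ∀ {K} →
                  (∀ {m} → m ≤ n → (gs : Vec Attribute m) → count (realised gs) ≤ K) →
                  ∃[ m ] IsL^ld U n m × 2 * k ≤ m × m ≤ 2 * K
  bounds⇒IsL^ld {n} {fs = fs} {x} sep {K} count≤K with separates⇒IsMinNodes≥ {fs = fs} {x} sep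
  ... | z , refl , z≥ =
    let k , min , _ = minNodes z
        m , (zₘ , dim≤n , minₘ) , max =
          greatest {P = Attained} (λ _ → em) (2 * K) attained≤ (k , z , ≤-refl , min)
    in m , record
      { attained = zₘ , dim≤n , minₘ
      ; maximal  = λ z dim≤n → let k , min , _ = minNodes z in k , min , max k (z , dim≤n , min)
      } , ≤-trans (z≥ min) (max k (z , ≤-refl , min)) , attained≤ m (zₘ , dim≤n , minₘ)
    where
    Attained : ℕ → Set (a ⊔ ℓ)
    Attained m = ∃[ z ] dim z ≤ n × IsMinNodes z m
    attained≤ : ∀ m → Attained m → m ≤ 2 * K
    attained≤ m (z , dim≤n , min) with minNodes z
    ... | k , minₖ , k≤ with refl ← IsMinNodes-unique min minₖ =
      ≤-trans k≤ (*-monoʳ-≤ 2 (count≤K dim≤n (attributes z)))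

  -- The polynomial and the exponential case

  finite-case : FiniteIDim U → ∃[ d ] IsIDim U d ×
    (∀ n → .{{NonZero n}} → ∃[ m ] IsL^ld U n m × 2 * (n + 1) ≤ m × m ≤ 2 * (4 * n) ^ d)
  finite-case finite with FiniteIDim⇒IsIDim finite
  ... | d , isDim = d , isDim , λ n → let fs , x , sep = separated-objects n in
    subst (λ k → ∃[ m ] IsL^ld U n m × 2 * k ≤ m × m ≤ 2 * (4 * n) ^ d) (+-comm 1 n)
      (bounds⇒IsL^ld {fs = fs} {x} sep λ m≤n gs →
        ≤-trans (IsIDim⇒count≤ isDim gs) (^-monoˡ-≤ d (1+m≤4*n m≤n)))
    where
    -- Sauer-Shelah gives the base m + 1; since n is positive, 1 + m is at most n + n and thus at
    -- most 4n.
    1+m≤4*n : .{{_ : NonZero n}} → m ≤ n → suc m ≤ 4 * n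
    1+m≤4*n {n} m≤n =
      ≤-trans (+-mono-≤ (>-nonZero⁻¹ n) m≤n) (+-monoʳ-≤ n (m≤m+n n _))

  -- Independent attributes realise every tuple, so one object per tuple gives 2^n separated
  -- objects. This meets the trivial upper bound on the number of tuples, and both bounds on the
  -- maximum become 2 * 2^n.
  infinite-case : InfiniteIDim U → ∀ n → .{{NonZero n}} → IsL^ld U n (2 ^ (n + 1))
  infinite-case infinite n =
    let fs , _ , all = infinite n
        m , isL , lower , upper = bounds⇒IsL^ld {k = 2 ^ n} {fs = fs} {λ i → proj₁ (all (tuple i))}
          (λ {i} {j} → independent⇒separates fs all {i} {j}) {2 ^ n} λ m≤n gs →
          ≤-trans (count≤2^n (realised gs)) (^-monoʳ-≤ 2 m≤n)
    in subst (IsL^ld U n) (trans (≤-antisym upper lower) (cong (2 ^_) (+-comm 1 n))) isL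
    where
    independent⇒separates : ∀ fs (all : ∀ δ → ∃[ x ] values {n} fs x ≡ δ) →
                            Separates fs (λ i → proj₁ (all (tuple i)))
    independent⇒separates fs all {i} {j} eq =
      tuple-injective (trans (sym (proj₂ (all (tuple i)))) (trans eq (proj₂ (all (tuple j)))))

proposition3 : ∀ {a ℓ} → ExcludedMiddle (a ⊔ ℓ) → (U : InfoSystem a ℓ) →
    (FiniteIDim U → ∃[ d ] IsIDim U d ×
    (∀ n → .{{NonZero n}} → ∃[ m ] IsL^ld U n m × 2 * (n + 1) ≤ m × m ≤ 2 * (4 * n) ^ d))
    × (InfiniteIDim U → ∀ n → .{{NonZero n}} → IsL^ld U n (2 ^ (n + 1)))
proposition3 em U = finite-case em U , infinite-case em U
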